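{- For each Sturmian permutation $\alpha$ we have $p^*_{\alpha}(n)=n$ for every integer $n\ge 1$.
   Context: $\mathbb N=\{0,1,2,\dots\}$. An infinite permutation (or $\mathbb N$-permutation) $\alpha$ is an equivalence class of sequences $(a_s)_{s\in\mathbb N}$ of pairwise distinct real numbers, where $(a_s)\sim(b_s)$ if and only if for all $s,r\in\mathbb N$ one has $a_s<a_r \iff b_s<b_r$. Equivalently, it is a linear ordering of the index set $\mathbb N$. The class of a sequence $a$ is denoted $\overline a$. A window is a finite set $T=\{0,m_1,\dots,m_{k-1}\}\subset\mathbb N$ with $0<m_1<\dots<m_{k-1}$; $\#T=k$. For $n\in\mathbb N$ the $T$-factor $\alpha_{T+n}$ is the restriction of $\alpha$ to $T+n$, regarded as a permutation on $T$ (via the shift by $n$). The number of distinct $T$-factors of $\alpha$ is denoted $p_\alpha(T)$, and the maximal pattern complexity of $\alpha$ is $p^*_\alpha(n)=\max_{\#T=n}p_\alpha(T)$. A one-sided infinite word $w=w_0w_1w_2\cdots$ on $\{0,1\}$ is Sturmian if for every $n$ it has exactly $n+1$ distinct factors (blocks of consecutive letters) of length $n$. Sturmian permutations: let $w$ be a Sturmian word on $\{0,1\}$ and let $x,y>0$ be real numbers such that $kx\neq ly$ whenever $k$ is the number of $0$'s and $l$ is the number of $1$'s in some nonempty factor of $w$. Let $a_0$ be any real number and, for $i\ge0$, let $a_{i+1}=a_i+x$ if $w_i=0$ and $a_{i+1}=a_i-y$ if $w_i=1$. The $a_i$ are pairwise distinct, and the Sturmian permutation associated with $w,x,y$ is $\alpha(w,x,y)=\overline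 a$. A Sturmian permutation is any permutation of the form $\alpha(w,x,y)$. -}

module Defs where

open import Data.Fin.Base using (Fin; toℕ)
import Data.Fin.Base as Fin
import Data.Fin.Properties as Fin
open import Data.Fin.Patterns using (0F; 1F)
open import Data.Nat.Base as ℕ using (ℕ; zero; suc)
import Data.Nat.Properties as ℕ
open import Data.Product.Base using (_×_; _,_; ∃-syntax)
open import Data.Rational.Base as ℚ using (ℚ; 0ℚ; ½)
import Data.Rational.Properties as ℚ
open import Data.Rational.Solver using (module +-*-Solver)
open import Data.Sum.Base using (_⊎_)
open import Data.Vec.Base using (Vec; tabulate; count)
open import Function.Base using (_∘_; id)
open import Function.Bundles using (Inverse)
open import Level using (0ℓ)
open import Relation.Binary.Bundles using (Setoid)
open import Relation.Binary.Core using (Rel; _⇔_; _Preserves_⟶_)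
import Relation.Binary.Construct.On as On
open import Relation.Binary.PropositionalEquality as ≡ using (_≡_; _≢_; refl; sym; trans; cong; subst)

------------------------------------------------------------------------
-- Real numbers, as Cauchy sequences of rationals.  They are only ever
-- compared by _<_, which is invariant under passing to another sequence
-- with the same limit.  Distinctness of reals is apartness _#_, which is
-- classically the same as the negation of equality.

IsCauchy : (ℕ → ℚ) → Set
IsCauchy u = ∀ ε → 0ℚ ℚ.< ε →
  ∃[ N ] (∀ m n → N ℕ.≤ m → N ℕ.≤ n → ℚ.∣ u m ℚ.- u n ∣ ℚ.< ε)

record ℝ : Set where
  constructor mkℝ
  field
    seq    : ℕ → ℚ
    cauchy : IsCauchy seq

open ℝ public

infix 4 _<_ _#_

_<_ : Rel ℝ 0ℓ
x < y = ∃[ ε ] (0ℚ ℚ.< ε × ∃[ N ] (∀ n → N ℕ.≤ n → seq x n ℚ.+ ε ℚ.≤ seq y n))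

_#_ : Rel ℝ 0ℓ
x # y = x < y ⊎ y < x

fromℚ : ℚ → ℝ
fromℚ q = mkℝ (λ _ → q) λ ε 0<ε → 0 , λ _ _ _ _ →
  subst (λ p → ℚ.∣ p ∣ ℚ.< ε) (sym (ℚ.+-inverseʳ q)) 0<ε

0ℝ : ℝ
0ℝ = fromℚ 0ℚ

infixl 6 _+_ _-_
infix  8 -_

private
  half-positive : ∀ ε → 0ℚ ℚ.< ε → 0ℚ ℚ.< ½ ℚ.* ε
  half-positive ε 0<ε = ℚ.positive⁻¹ (½ ℚ.* ε)
    {{ℚ.pos*pos⇒pos ½ ε {{ℚ.positive 0<ε}}}}

  halves : ∀ ε → ½ ℚ.* ε ℚ.+ ½ ℚ.* ε ≡ ε
  halves ε = trans (sym (ℚ.*-distribʳ-+ ε ½ ½)) (ℚ.*-identityˡ ε)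

  +-interchange : ∀ a b c d → (a ℚ.+ b) ℚ.- (c ℚ.+ d) ≡ (a ℚ.- c) ℚ.+ (b ℚ.- d)
  +-interchange = solve 4 (λ a b c d → (a :+ b) :- (c :+ d) := (a :- c) :+ (b :- d)) refl
    where open +-*-Solver

_+_ : ℝ → ℝ → ℝ
x + y = mkℝ (λ n → seq x n ℚ.+ seq y n) λ ε 0<ε →
  let (M , close-x) = cauchy x (½ ℚ.* ε) (half-positive ε 0<ε)
      (N , close-y) = cauchy y (½ ℚ.* ε) (half-positive ε 0<ε)
  in M ℕ.⊔ N , λ m n M⊔N≤m M⊔N≤n → let open ℚ.≤-Reasoning in begin-strict
    ℚ.∣ (seq x m ℚ.+ seq y m) ℚ.- (seq x n ℚ.+ seq y n) ∣
      ≡⟨ cong ℚ.∣_∣ (+-interchange (seq x m) (seq y m) (seq x n) (seq y n)) ⟩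
    ℚ.∣ (seq x m ℚ.- seq x n) ℚ.+ (seq y m ℚ.- seq y n) ∣
      ≤⟨ ℚ.∣p+q∣≤∣p∣+∣q∣ (seq x m ℚ.- seq x n) (seq y m ℚ.- seq y n) ⟩
    ℚ.∣ seq x m ℚ.- seq x n ∣ ℚ.+ ℚ.∣ seq y m ℚ.- seq y n ∣
      <⟨ ℚ.+-mono-< (close-x m n (ℕ.m⊔n≤o⇒m≤o M N M⊔N≤m) (ℕ.m⊔n≤o⇒m≤o M N M⊔N≤n))
                    (close-y m n (ℕ.m⊔n≤o⇒n≤o M N M⊔N≤m) (ℕ.m⊔n≤o⇒n≤o M N M⊔N≤n)) ⟩
    ½ ℚ.* ε ℚ.+ ½ ℚ.* ε
      ≡⟨ halves ε ⟩
    ε ∎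

-_ : ℝ → ℝ
- x = mkℝ (λ n → ℚ.- seq x n) λ ε 0<ε →
  let (N , close) = cauchy x ε 0<ε
  in N , λ m n N≤m N≤n → subst (ℚ._< ε)
       (trans (sym (ℚ.∣-p∣≡∣p∣ (seq x m ℚ.- seq x n)))
              (cong ℚ.∣_∣ (ℚ.neg-distrib-+ (seq x m) (ℚ.- seq x n))))
       (close m n N≤m N≤n)

_-_ : ℝ → ℝ → ℝ
x - y = x + (- y)

infixr 8 _·_

_·_ : ℕ → ℝ → ℝ
zero  · x = 0ℝ
suc n · x = x + n · x

------------------------------------------------------------------------
-- The number of distinct values of a family f : ℕ → S is c when ℕ,
-- with i and j identified as soon as f i ≈ f j, is in bijection with Fin c.

HasDistinctValues : ∀ {a ℓ} (S : Setoid a ℓ) → (ℕ → Setoid.Carrier S) → ℕ → Set ℓ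
HasDistinctValues S f c = Inverse (On.setoid S f) (≡.setoid (Fin c))

------------------------------------------------------------------------
-- Infinite words on {0,1}

Word : Set
Word = ℕ → Fin 2

-- w i, w (i + 1), …, w (i + n - 1)
block : Word → (n : ℕ) → ℕ → Vec (Fin 2) n
block w n i = tabulate λ j → w (i ℕ.+ toℕ j)

∣_∣₀ ∣_∣₁ : ∀ {n} → Vec (Fin 2) n → ℕ
∣ u ∣₀ = count (Fin._≟ 0F) u
∣ u ∣₁ = count (Fin._≟ 1F) u

SturmianWord : Word → Set
SturmianWord w = ∀ n → HasDistinctValues (≡.setoid (Vec (Fin 2) n)) (block w n) (suc n)

------------------------------------------------------------------------
-- Infinite permutations

-- The linear order on the index set induced by a family of reals.
order : ∀ {A : Set} → (A → ℝ) → Rel A 0ℓ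
order a s r = a s < a r

infix 4 _∼_

_∼_ : ∀ {A : Set} → (A → ℝ) → (A → ℝ) → Set
a ∼ b = order a ⇔ order b

∼-setoid : Set → Setoid 0ℓ 0ℓ
∼-setoid A = record
  { Carrier       = A → ℝ
  ; _≈_           = _∼_
  ; isEquivalence = record
    { refl  = id , id
    ; sym   = λ (f , g) → g , f
    ; trans = λ (f , g) (f′ , g′) → f′ ∘ f , g ∘ g′
    }
  }

-- A representative of an infinite permutation; two of them are the same
-- permutation when their values are related by _∼_.
record Permutation : Set where
  field
    value    : ℕ → ℝ
    distinct : ∀ {s r} → s ≢ r → value s # value r

open Permutation public

-- A window of cardinality k, given by its increasing enumeration.
record Window (k : ℕ) : Set where
  field
    element    : Fin k → ℕ
    increasing : element Preserves Fin._<_ ⟶ ℕ._<_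
    contains-0 : ∃[ i ] element i ≡ 0

open Window public

-- The restriction of α to T + n, up to _∼_ a permutation of (the indices
-- of) the elements of T.
factor : ∀ {k} → Permutation → Window k → ℕ → (Fin k → ℝ)
factor α T n i = value α (element T i ℕ.+ n)

-- p_α(T) = c
PatternComplexity : ∀ {k} → Permutation → Window k → ℕ → Set
PatternComplexity {k} α T c = HasDistinctValues (∼-setoid (Fin k)) (factor α T) c

-- p*_α(n) = c.  The second component also asserts that every p_α(T) exists.
MaximalPatternComplexity : Permutation → ℕ → ℕ → Set
MaximalPatternComplexity α n c =
    (∃[ T ] PatternComplexity {n} α T c)
  × (∀ (T : Window n) → ∃[ d ] (PatternComplexity α T d × d ℕ.≤ c))

------------------------------------------------------------------------
-- Sturmian permutations

step : Fin 2 → ℝ → ℝ → ℝ → ℝ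
step 0F x y a = a + x
step 1F x y a = a - y

walk : Word → (x y a₀ : ℝ) → ℕ → ℝ
walk w x y a₀ zero    = a₀
walk w x y a₀ (suc i) = step (w i) x y (walk w x y a₀ i)

Admissible : Word → (x y : ℝ) → Set
Admissible w x y = ∀ n i →
  let u = block w (suc n) i in ∣ u ∣₀ · x # ∣ u ∣₁ · y

record SturmianPermutation (α : Permutation) : Set where
  field
    w          : Word
    x y a₀     : ℝ
    sturmian   : SturmianWord w
    x-positive : 0ℝ < x
    y-positive : 0ℝ < y
    admissible : Admissible w x y
    represents : value α ∼ walk w x y a₀

-- Sturmian words are balanced.  A minimal pair of unbalanced blocks has the form
-- 1u1, 0u0 with u a palindrome; since an aperiodic word has a right special block
-- of length n among any n + 1 consecutive ones, and at an overlap with 1u1 (resp.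
-- 0u0) it can only be 1u (resp. 0u), both 1u and 0u would be right special,
-- whereas complexity n + 1 leaves room for only one.
-- The T-factor at p depends only on the numbers of ones in the blocks from p to
-- p + m, m ∈ T.  By balance these vectors form a chain whose entries vary by at
-- most 1, and not at all for m = 0, so their sums take at most #T values.
-- For T = {0, …, n - 1} the factor determines the block of length n - 1, which
-- gives n distinct factors.
module Submission where

open import Defs hiding (_+_; _<_)
import Defs as ℝ
open import Algebra.Definitions.RawMonoid using (sum)
open import Data.Empty using (⊥; ⊥-elim)
open import Data.Fin.Base as Fin using (Fin; toℕ; fromℕ<)
open import Data.Fin.Patterns using (0F; 1F)
import Data.Fin.Properties as Fin
open import Data.Nat.Base using (ℕ; zero; suc; _≥_; _≤_; _<_; _+_; _*_; z≤n; s≤s; _∸_; _%_; _/_; NonZero)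
import Data.Nat.Base as ℕ
open import Data.Nat.DivMod using (m≡m%n+[m/n]*n; m%n<n)
open import Data.Nat.Induction using (<-rec)
import Data.Nat.Properties as ℕ
open import Data.Nat.Tactic.RingSolver using (solve-∀)
open import Data.Product.Base using (_×_; _,_; ∃-syntax; Σ-syntax; proj₁; proj₂)
open import Data.Rational.Base as ℚ using (ℚ; 0ℚ)
import Data.Rational.Properties as ℚ
open import Data.Rational.Solver using (module +-*-Solver)
open import Data.Sum.Base using (_⊎_; inj₁; inj₂)
open import Data.Vec.Base using (lookup)
import Data.Vec.Properties as Vec
open import Function.Base using (_∘_; case_of_)
open import Function.Bundles using (Inverse)
open import Relation.Binary.Bundles using (Setoid)
import Relation.Binary.Construct.On as On
open import Relation.Binary.Core using (Rel)
open import Relation.Binary.PropositionalEquality hiding (setoid)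
open import Relation.Binary.Structures using (IsDecEquivalence)
open import Relation.Nullary using (¬_; Dec; yes; no; contradiction; map′; _×-dec_; _→-dec_)

-- Finite sums and remainders.

private
  Σ : ∀ {n} → (Fin n → ℕ) → ℕ
  Σ = sum ℕ.+-0-rawMonoid

Σ-mono-≤ : ∀ {n} {f g : Fin n → ℕ} → (∀ i → f i ≤ g i) → Σ f ≤ Σ g
Σ-mono-≤ {zero}  _   = z≤n
Σ-mono-≤ {suc _} f≤g = ℕ.+-mono-≤ (f≤g 0F) (Σ-mono-≤ (f≤g ∘ Fin.suc))

-- Slack in one term cannot be made up by the others.
Σ-≡⇒≗ : ∀ {n} {f g : Fin n → ℕ} → (∀ i → f i ≤ g i) → Σ f ≡ Σ g → f ≗ g
Σ-≡⇒≗ {suc _} {f} {g} f≤g e = go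
  where
  head : f 0F ≡ g 0F
  head = ℕ.≤-antisym (f≤g 0F) (ℕ.+-cancelʳ-≤ (Σ (f ∘ Fin.suc)) _ _
    (ℕ.≤-trans (ℕ.+-monoʳ-≤ (g 0F) (Σ-mono-≤ (f≤g ∘ Fin.suc))) (ℕ.≤-reflexive (sym e))))
  go : f ≗ g
  go 0F          = head
  go (Fin.suc i) = Σ-≡⇒≗ (f≤g ∘ Fin.suc)
    (ℕ.+-cancelˡ-≡ (g 0F) _ _ (trans (cong (_+ Σ (f ∘ Fin.suc)) (sym head)) e)) i

≤-Σ : ∀ {n} (f : Fin n → ℕ) i → f i ≤ Σ f
≤-Σ f 0F          = ℕ.m≤m+n _ _
≤-Σ f (Fin.suc i) = ℕ.≤-trans (≤-Σ (f ∘ Fin.suc) i) (ℕ.m≤n+m _ _)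

Σ-suc : ∀ {n} (f : Fin n → ℕ) → Σ (suc ∘ f) ≡ n + Σ f
Σ-suc {zero}  f = refl
Σ-suc {suc n} f = cong suc (begin
  f 0F + Σ (suc ∘ f ∘ Fin.suc)    ≡⟨ cong (f 0F +_) (Σ-suc (f ∘ Fin.suc)) ⟩
  f 0F + (n + Σ (f ∘ Fin.suc))    ≡⟨ ℕ.+-assoc (f 0F) n _ ⟨
  f 0F + n + Σ (f ∘ Fin.suc)      ≡⟨ cong (_+ Σ (f ∘ Fin.suc)) (ℕ.+-comm (f 0F) n) ⟩
  n + f 0F + Σ (f ∘ Fin.suc)      ≡⟨ ℕ.+-assoc n (f 0F) _ ⟩
  n + (f 0F + Σ (f ∘ Fin.suc))    ∎)
  where open ≡-Reasoning

-- The right-hand side is the sum of the bounds `suc (g i)`; equality would make all of them tight,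
-- even where `f i ≤ g i`.
Σ-<-+ : ∀ {n} {f g : Fin n → ℕ} → (∀ i → f i ≤ suc (g i)) → (∃[ i ] f i ≤ g i) → Σ f < n + Σ g
Σ-<-+ {n} {f} {g} f≤1+g (i , fi≤gi) = subst (Σ f <_) (Σ-suc g)
  (ℕ.≤∧≢⇒< (Σ-mono-≤ f≤1+g) λ e → ℕ.<⇒≢ (s≤s fi≤gi) (Σ-≡⇒≗ f≤1+g e i))

-- Among `d` consecutive numbers each remainder occurs once: with equal remainders, `n < d + m`
-- leaves no room for a larger quotient.
%-≡⇒≡ : ∀ {m n d} .{{_ : NonZero d}} → m ≤ n → n < d + m → m % d ≡ n % d → m ≡ n
%-≡⇒≡ {m} {n} {d} m≤n n<d+m e = ℕ.≤-antisym m≤n (begin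
  n                    ≡⟨ m≡m%n+[m/n]*n n d ⟩
  n % d + (n / d) * d  ≤⟨ ℕ.+-mono-≤ (ℕ.≤-reflexive (sym e)) (ℕ.*-monoˡ-≤ d (ℕ.≤-pred quotient<)) ⟩
  m % d + (m / d) * d  ≡⟨ m≡m%n+[m/n]*n m d ⟨
  m                    ∎)
  where
  open ℕ.≤-Reasoning
  quotient< : n / d < suc (m / d)
  quotient< = ℕ.*-cancelʳ-< d _ _ (ℕ.+-cancelˡ-< (m % d) _ _ (begin-strict
    m % d + (n / d) * d        ≡⟨ cong (_+ (n / d) * d) e ⟩
    n % d + (n / d) * d        ≡⟨ m≡m%n+[m/n]*n n d ⟨
    n                          <⟨ n<d+m ⟩
    d + m                      ≡⟨ cong (d +_) (m≡m%n+[m/n]*n m d) ⟩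
    d + (m % d + (m / d) * d)  ≡⟨ swap d (m % d) _ ⟩
    m % d + (d + (m / d) * d)  ∎))
    where
    swap : ∀ a b c → a + (b + c) ≡ b + (a + c)
    swap = solve-∀

-- Blocks of a Sturmian word and their numbering.

module SturmianCombinatorics (w : Word) (sturmian : SturmianWord w) where

  -- Letters are compared at natural offsets, so that blocks can be shortened, extended and shifted
  -- without arithmetic in `Fin`.
  SameBlock : ℕ → ℕ → ℕ → Set
  SameBlock n i j = ∀ k → k < n → w (i + k) ≡ w (j + k)

  SameBlock⇒≡ : ∀ {n i j} → SameBlock n i j → block w n i ≡ block w n j
  SameBlock⇒≡ same = Vec.tabulate-cong λ k → same (toℕ k) (Fin.toℕ<n k)

  ≡⇒SameBlock : ∀ {n i j} → block w n i ≡ block w n j → SameBlock n i j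
  ≡⇒SameBlock {n} {i} {j} eq k k<n = subst (λ l → w (i + l) ≡ w (j + l)) (Fin.toℕ-fromℕ< k<n)
    (begin
      w (i + toℕ (fromℕ< k<n))              ≡⟨ Vec.lookup∘tabulate _ (fromℕ< k<n) ⟨
      lookup (block w n i) (fromℕ< k<n)     ≡⟨ cong (λ u → lookup u (fromℕ< k<n)) eq ⟩
      lookup (block w n j) (fromℕ< k<n)     ≡⟨ Vec.lookup∘tabulate _ (fromℕ< k<n) ⟩
      w (j + toℕ (fromℕ< k<n))              ∎)
    where open ≡-Reasoning

  same-trans : ∀ {n i j k} → SameBlock n i j → SameBlock n j k → SameBlock n i k
  same-trans s t l l<n = trans (s l l<n) (t l l<n)

  same-sym : ∀ {n i j} → SameBlock n i j → SameBlock n j i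
  same-sym s l l<n = sym (s l l<n)

  same-init : ∀ {n i j} → SameBlock (suc n) i j → SameBlock n i j
  same-init s l l<n = s l (ℕ.m<n⇒m<1+n l<n)

  same-tail : ∀ {n i j} → SameBlock (suc n) i j → SameBlock n (suc i) (suc j)
  same-tail {n} {i} {j} s l l<n =
    subst₂ (λ a b → w a ≡ w b) (ℕ.+-suc i l) (ℕ.+-suc j l) (s (suc l) (s≤s l<n))

  same-snoc : ∀ {n i j} → SameBlock n i j → w (i + n) ≡ w (j + n) → SameBlock (suc n) i j
  same-snoc {n} s e l l<1+n with ℕ.m≤n⇒m<n∨m≡n (ℕ.≤-pred l<1+n)
  ... | inj₁ l<n  = s l l<n
  ... | inj₂ refl = e

  same-cons : ∀ {n i j} → w i ≡ w j → SameBlock n (suc i) (suc j) → SameBlock (suc n) i j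
  same-cons {n} {i} {j} e s zero    _         =
    subst₂ (λ a b → w a ≡ w b) (sym (ℕ.+-identityʳ i)) (sym (ℕ.+-identityʳ j)) e
  same-cons {n} {i} {j} e s (suc l) (s≤s l<n) =
    subst₂ (λ a b → w a ≡ w b) (sym (ℕ.+-suc i l)) (sym (ℕ.+-suc j l)) (s l l<n)

  same-head : ∀ {n i j} → 0 < n → SameBlock n i j → w i ≡ w j
  same-head {i = i} {j} 0<n s =
    subst₂ (λ a b → w a ≡ w b) (ℕ.+-identityʳ i) (ℕ.+-identityʳ j) (s 0 0<n)

  class : ∀ n → ℕ → Fin (suc n)
  class n = Inverse.to (sturmian n)

  rep : ∀ n → Fin (suc n) → ℕ
  rep n = Inverse.from (sturmian n)

  same⇒class≡ : ∀ {n i j} → SameBlock n i j → class n i ≡ class n j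
  same⇒class≡ {n} s = Inverse.to-cong (sturmian n) (SameBlock⇒≡ s)

  rep-class : ∀ n i → SameBlock n (rep n (class n i)) i
  rep-class n i = ≡⇒SameBlock (Inverse.strictlyInverseʳ (sturmian n) i)

  class≡⇒same : ∀ {n i j} → class n i ≡ class n j → SameBlock n i j
  class≡⇒same {n} {i} {j} e = same-trans (same-sym (rep-class n i))
    (subst (λ c → SameBlock n (rep n c) j) (sym e) (rep-class n j))

  class-rep : ∀ {n} c → class n (rep n c) ≡ c
  class-rep {n} = Inverse.strictlyInverseˡ (sturmian n)

  rep-injective : ∀ {n c d} → SameBlock n (rep n c) (rep n d) → c ≡ d
  rep-injective {c = c} {d} s = trans (sym (class-rep c)) (trans (same⇒class≡ s) (class-rep d))

  -- Repetitions and aperiodicity.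

  repetition : ∀ n (g : Fin (2 + n) → ℕ) → ∃[ a ] ∃[ b ] (a Fin.< b × SameBlock n (g a) (g b))
  repetition n g with a , b , a<b , e ← Fin.pigeonhole ℕ.≤-refl (class n ∘ g) =
    a , b , a<b , class≡⇒same e

  -- If the tails at a < b agreed, every block would occur before b.
  aperiodic : ∀ {a b} → a < b → ¬ (∀ k → w (a + k) ≡ w (b + k))
  aperiodic {a} {b} a<b periodic =
    -- Length `b` gives `b + 1` different blocks, one more than there are positions before `b`.
    let c , d , c<d , e = Fin.pigeonhole (ℕ.n<1+n b) early
    in ℕ.<⇒≢ c<d (cong toℕ (rep-injective {b} {c} {d} λ k _ →
         trans (early-same c k) (trans (cong (λ l → w (toℕ l + k)) e) (sym (early-same d k)))))
    where
    early-tail : ∀ i → ∃[ j ] (j < b × (∀ k → w (i + k) ≡ w (j + k)))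
    early-tail zero = 0 , ℕ.≤-<-trans z≤n a<b , λ _ → refl
    early-tail (suc i) with j , j<b , same ← early-tail i | ℕ.m≤n⇒m<n∨m≡n j<b
    ... | inj₁ 1+j<b = suc j , 1+j<b , λ k →
      subst₂ (λ x y → w x ≡ w y) (ℕ.+-suc i k) (ℕ.+-suc j k) (same (suc k))
    ... | inj₂ refl  = a , a<b , λ k → trans
      (subst₂ (λ x y → w x ≡ w y) (ℕ.+-suc i k) (ℕ.+-suc j k) (same (suc k))) (sym (periodic k))

    early : Fin (suc b) → Fin b
    early c = let _ , j<b , _ = early-tail (rep b c) in fromℕ< j<b

    early-same : ∀ c k → w (rep b c + k) ≡ w (toℕ (early c) + k)
    early-same c k with j , j<b , same ← early-tail (rep b c) =
      trans (same k) (cong (λ l → w (l + k)) (sym (Fin.toℕ-fromℕ< j<b)))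

  -- Right special blocks.

  RightSpecial : ℕ → ℕ → Set
  RightSpecial n i = ∃[ j ] (SameBlock n i j × w (i + n) ≢ w (j + n))

  special-tail : ∀ {n i} → RightSpecial (suc n) i → RightSpecial n (suc i)
  special-tail {n} {i} (j , same , differ) = suc j , same-tail same ,
    subst₂ (λ a b → w a ≢ w b) (ℕ.+-suc i n) (ℕ.+-suc j n) differ

  -- A block that is not right special determines its next letter, hence also the block one place
  -- further on.
  next-same : ∀ {n i j} → ¬ RightSpecial n i → SameBlock n i j → SameBlock n (suc i) (suc j)
  next-same {n} {i} {j} nonspecial same with w (i + n) Fin.≟ w (j + n)
  ... | yes e = same-tail (same-snoc same e)
  ... | no ¬e = contradiction (j , same , ¬e) nonspecial

  -- Without right special blocks between two occurrences of the same block,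
  -- the word would be periodic from there on.
  nonspecial-between : ∀ {n a b} → a < b → SameBlock n a b →
                       ¬ (∀ c → a ≤ c → c < b → ¬ RightSpecial n c)
  nonspecial-between {n} {a} {b} a<b same-ab nonspecial = aperiodic a<b λ k →
    subst₂ (λ i j → w i ≡ w j) (ℕ.+-comm k a) (ℕ.+-comm k b) (same-letter k)
    where
    early-block : ∀ k → ∃[ c ] (a ≤ c × c < b × SameBlock n (k + a) c)
    early-block zero = a , ℕ.≤-refl , a<b , λ _ _ → refl
    early-block (suc k) with c , a≤c , c<b , same ← early-block k =
      case ℕ.m≤n⇒m<n∨m≡n c<b of λ where
        (inj₁ 1+c<b) → suc c , ℕ.m≤n⇒m≤1+n a≤c , 1+c<b , next
        (inj₂ refl)  → a , ℕ.≤-refl , a<b , same-trans next (same-sym same-ab)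
      where
      next : SameBlock n (suc k + a) (suc c)
      next = same-sym (next-same (nonspecial c a≤c c<b) (same-sym same))

    -- The block at `k + a` also occurs at some `c` with `a ≤ c < b`. Were it right special, so
    -- would be the one at `c`: the other continuation is found at `j` or at `k + a` itself.
    always-nonspecial : ∀ k → ¬ RightSpecial n (k + a)
    always-nonspecial k (j , same , differ) with c , a≤c , c<b , same′ ← early-block k
      with w (k + a + n) Fin.≟ w (c + n)
    ... | yes e = nonspecial c a≤c c<b (j , same-trans (same-sym same′) same , differ ∘ trans e)
    ... | no ¬e = nonspecial c a≤c c<b (k + a , same-sym same′ , ¬e ∘ sym)

    same-shift : ∀ k → SameBlock n (k + a) (k + b)
    same-shift zero    = same-ab
    same-shift (suc k) = next-same (always-nonspecial k) (same-shift k)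

    same-letter : ∀ k → w (k + a) ≡ w (k + b)
    same-letter k with w (k + a + n) Fin.≟ w (k + b + n)
    ... | yes e = same-head (s≤s z≤n) (same-snoc (same-shift k) e)
    ... | no ¬e = contradiction (k + b , same-shift k , ¬e) (always-nonspecial k)

  -- Two of the `n + 2` positions from `i` on carry the same block, and a right special one starts
  -- before the second of them, hence at offset at most `n`. Refuting absence is enough for deriving
  -- a contradiction.
  special-recurrence : ∀ n i → ¬ (∀ k → k ≤ n → ¬ RightSpecial n (i + k))
  special-recurrence n i nonspecial
    with a , b , a<b , same ← repetition n (λ c → i + toℕ c) =
    nonspecial-between (ℕ.+-monoʳ-< i a<b) same λ c i+a≤c c<i+b special →
      let i≤c = ℕ.≤-trans (ℕ.m≤m+n i (toℕ a)) i+a≤c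
          i+k≡c = ℕ.m+[n∸m]≡n i≤c
          k<b = ℕ.+-cancelˡ-< i (c ∸ i) (toℕ b) (subst (ℕ._< i + toℕ b) (sym i+k≡c) c<i+b)
      in nonspecial (c ∸ i) (ℕ.≤-pred (ℕ.≤-trans k<b (Fin.toℕ≤pred[n] b)))
           (subst (RightSpecial n) (sym i+k≡c) special)

  -- Otherwise the two extra extensions would give n + 3 blocks of length n + 1.
  special-unique : ∀ {n a b} → RightSpecial n a → RightSpecial n b → SameBlock n a b
  special-unique {n} {a} {b} special-a special-b with class n a Fin.≟ class n b
  ... | yes e = class≡⇒same e
  ... | no a≢b = contradiction (repetition (suc n) g) no-repetition
    where
    -- Of the two continuations of the block, the one that its representative does not have.
    other : ∀ {i} → RightSpecial n i →
            ∃[ j ] (class n j ≡ class n i × w (j + n) ≢ w (rep n (class n i) + n))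
    other {i} (j , same , differ) with w (i + n) Fin.≟ w (rep n (class n i) + n)
    ... | yes e = j , sym (same⇒class≡ same) , λ e′ → differ (trans e (sym e′))
    ... | no ¬e = i , refl , ¬e

    g : Fin (2 + suc n) → ℕ
    g 0F                    = proj₁ (other special-a)
    g 1F                    = proj₁ (other special-b)
    g (Fin.suc (Fin.suc c)) = rep n c

    not-rep : ∀ {i} (special : RightSpecial n i) c →
              ¬ SameBlock (suc n) (proj₁ (other special)) (rep n c)
    not-rep {i} special c same with j , e , differ ← other special = differ
      (trans (same n ℕ.≤-refl) (cong (λ d → w (rep n d + n))
        (trans (sym (class-rep c)) (trans (sym (same⇒class≡ (same-init same))) e))))

    no-repetition : ¬ (∃[ c ] ∃[ d ] (c Fin.< d × SameBlock (suc n) (g c) (g d)))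
    no-repetition (0F , 0F , () , _)
    no-repetition (0F , 1F , _ , same) = a≢b
      (trans (sym (proj₁ (proj₂ (other special-a))))
        (trans (same⇒class≡ (same-init same)) (proj₁ (proj₂ (other special-b)))))
    no-repetition (0F , Fin.suc (Fin.suc d) , _ , same) = not-rep special-a d same
    no-repetition (1F , 1F , s≤s () , _)
    no-repetition (1F , Fin.suc (Fin.suc d) , _ , same) = not-rep special-b d same
    no-repetition (Fin.suc (Fin.suc c) , 1F , s≤s () , _)
    no-repetition (Fin.suc (Fin.suc c) , Fin.suc (Fin.suc d) , s≤s (s≤s c<d) , same) =
      ℕ.<⇒≢ c<d (cong toℕ (rep-injective (same-init same)))

  -- Numbers of ones and balance.

  ones : ℕ → ℕ → ℕ
  ones p zero    = 0
  ones p (suc l) = toℕ (w (p + l)) + ones p l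

  ones-+ : ∀ p k l → ones p (k + l) ≡ ones p k + ones (p + k) l
  ones-+ p k zero    = trans (cong (ones p) (ℕ.+-identityʳ k)) (sym (ℕ.+-identityʳ _))
  ones-+ p k (suc l) = begin
    ones p (k + suc l)                                       ≡⟨ cong (ones p) (ℕ.+-suc k l) ⟩
    toℕ (w (p + (k + l))) + ones p (k + l)
      ≡⟨ cong₂ (λ i o → toℕ (w i) + o) (sym (ℕ.+-assoc p k l)) (ones-+ p k l) ⟩
    toℕ (w (p + k + l)) + (ones p k + ones (p + k) l)
      ≡⟨ swap (toℕ (w (p + k + l))) (ones p k) (ones (p + k) l) ⟩
    ones p k + (toℕ (w (p + k + l)) + ones (p + k) l)        ∎
    where
    open ≡-Reasoning
    swap : ∀ a b c → a + (b + c) ≡ b + (a + c)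
    swap = solve-∀

  ones-cons : ∀ p l → ones p (suc l) ≡ toℕ (w p) + ones (suc p) l
  ones-cons p l = begin
    ones p (1 + l)                           ≡⟨ ones-+ p 1 l ⟩
    toℕ (w (p + 0)) + 0 + ones (p + 1) l
      ≡⟨ cong₂ (λ a b → a + ones b l) (ℕ.+-identityʳ _) (ℕ.+-comm p 1) ⟩
    toℕ (w (p + 0)) + ones (suc p) l
      ≡⟨ cong (λ i → toℕ (w i) + ones (suc p) l) (ℕ.+-identityʳ p) ⟩
    toℕ (w p) + ones (suc p) l               ∎
    where open ≡-Reasoning

  Balanced : ℕ → Set
  Balanced l = ∀ p q → ones p l ≤ suc (ones q l)

  private
    -- The two upper bounds add up exactly to the lower bound on `a + b`, so neither has slack.
    tight : ∀ {a b c d} → a ≤ suc c → b ≤ suc d → 2 + (c + d) ≤ a + b → a ≡ suc c × b ≡ suc d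
    tight {a} {b} {c} {d} a≤ b≤ ≤a+b =
        ℕ.≤-antisym a≤ (ℕ.+-cancelʳ-≤ (suc d) (suc c) a (ℕ.≤-trans lower (ℕ.+-monoʳ-≤ a b≤)))
      , ℕ.≤-antisym b≤ (ℕ.+-cancelˡ-≤ (suc c) (suc d) b (ℕ.≤-trans lower (ℕ.+-monoˡ-≤ b a≤)))
      where
      lower : suc c + suc d ≤ a + b
      lower = subst (_≤ a + b) (cong suc (sym (ℕ.+-suc c d))) ≤a+b

    extreme-letters : ∀ (a b : Fin 2) → toℕ b < toℕ a → a ≡ 1F × b ≡ 0F
    extreme-letters 0F 0F ()
    extreme-letters 0F 1F ()
    extreme-letters 1F 0F _ = refl , refl
    extreme-letters 1F 1F (s≤s ())

  -- Here `n` is the last offset and not the length: the block consists of the `n + 1` letters from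
  -- `r` to `r + n`.
  PalindromeAt : ℕ → ℕ → Set
  PalindromeAt n r = ∀ k t → k + t ≡ n → w (r + k) ≡ w (r + t)

  -- An overlap of c u c (u of length m) with another occurrence of u, preceded
  -- by d, puts d at the position mirroring that of a letter aligned with the last c.
  palindrome-overlap : ∀ {m r k} → PalindromeAt (suc m) r → k ≤ suc m →
                       SameBlock m (suc (r + k)) (suc r) → w (r + k) ≡ w r
  palindrome-overlap {m} {r} {zero}  _   _   _    = cong w (ℕ.+-identityʳ r)
  palindrome-overlap {m} {r} {suc k} pal (s≤s k≤m) same with ℕ.m≤n⇒∃[o]m+o≡n k≤m
  ... | zero  , e = trans (pal (suc k) 0 (cong suc e)) (cong w (ℕ.+-identityʳ r))
  ... | suc t , e = begin
    w (r + suc k)            ≡⟨ pal (suc k) (suc t) (cong suc e) ⟩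
    w (r + suc t)            ≡⟨ cong w (ℕ.+-suc r t) ⟩
    w (suc r + t)            ≡⟨ same t (subst (t <_) e (ℕ.m≤n+m (suc t) k)) ⟨
    w (suc (r + suc k) + t)  ≡⟨ cong w (trans (shift r k t) (cong (λ l → r + suc l) e)) ⟩
    w (r + suc m)            ≡⟨ pal (suc m) 0 (ℕ.+-identityʳ (suc m)) ⟩
    w (r + 0)                ≡⟨ cong w (ℕ.+-identityʳ r) ⟩
    w r                      ∎
    where
    open ≡-Reasoning
    shift : ∀ r k t → suc (r + suc k) + t ≡ r + suc (k + suc t)
    shift = solve-∀

  -- The blocks of length 2 + m at p and q turn out to be 1u1 and 0u0 with a palindrome u.
  module MinimalImbalance (m : ℕ) (balanced : ∀ {k} → k ≤ suc m → Balanced k)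
                          (p q : ℕ) (imbalance : 2 + ones q (2 + m) ≤ ones p (2 + m)) where

    -- A cut leaves two shorter pieces, each in excess by at most one by balance, while the total
    -- excess is at least two. So each piece at `p` has exactly one 1 more than its counterpart at
    -- `q`.
    prefix-suffix : ∀ k t → k + suc t ≡ suc m →
                    ones p (suc k) ≡ suc (ones q (suc k)) ×
                    ones (p + suc k) (suc t) ≡ suc (ones (q + suc k) (suc t))
    prefix-suffix k t e = tight
      (balanced (subst (suc k ≤_) (trans (sym (ℕ.+-suc k t)) e) (ℕ.m≤m+n (suc k) t)) p q)
      (balanced (subst (suc t ≤_) e (ℕ.m≤n+m (suc t) k)) _ _)
      (subst₂ (λ a b → 2 + a ≤ b) (split q) (split p) imbalance)
      where
      split : ∀ r → ones r (2 + m) ≡ ones r (suc k) + ones (r + suc k) (suc t)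
      split r = trans (cong (ones r ∘ suc) (sym e)) (ones-+ r (suc k) (suc t))

    prefix : ∀ k t → k + suc t ≡ suc m → ones p (suc k) ≡ suc (ones q (suc k))
    prefix k t e = proj₁ (prefix-suffix k t e)

    first : w p ≡ 1F × w q ≡ 0F
    first = extreme-letters (w p) (w q) (ℕ.≤-reflexive (sym (begin
      toℕ (w p)              ≡⟨ cong (toℕ ∘ w) (sym (ℕ.+-identityʳ p)) ⟩
      toℕ (w (p + 0))        ≡⟨ ℕ.+-identityʳ _ ⟨
      ones p 1               ≡⟨ prefix 0 m refl ⟩
      suc (ones q 1)         ≡⟨ cong suc (ℕ.+-identityʳ _) ⟩
      suc (toℕ (w (q + 0)))  ≡⟨ cong (suc ∘ toℕ ∘ w) (ℕ.+-identityʳ q) ⟩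
      suc (toℕ (w q))        ∎)))
      where open ≡-Reasoning

    last : w (p + suc m) ≡ 1F × w (q + suc m) ≡ 0F
    last = extreme-letters _ _ (ℕ.+-cancelʳ-≤ (suc (ones q (suc m))) _ _ (begin
      suc (toℕ (w (q + suc m))) + suc (ones q (suc m))  ≡⟨ cong suc (ℕ.+-suc _ (ones q (suc m))) ⟩
      2 + ones q (2 + m)                                ≤⟨ imbalance ⟩
      toℕ (w (p + suc m)) + ones p (suc m)
        ≡⟨ cong (toℕ (w (p + suc m)) +_) (prefix m 0 (ℕ.+-comm m 1)) ⟩
      toℕ (w (p + suc m)) + suc (ones q (suc m))        ∎))
      where open ℕ.≤-Reasoning

    -- The excess of the prefixes is one both before and after an inner letter, so that letter
    -- contributes nothing to it.
    inner : ∀ k → k < m → w (suc p + k) ≡ w (suc q + k)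
    inner k k<m with t , e ← ℕ.m≤n⇒∃[o]m+o≡n k<m = subst₂ (λ i j → w i ≡ w j) (ℕ.+-suc p k) (ℕ.+-suc q k)
      (Fin.toℕ-injective (ℕ.+-cancelʳ-≡ (suc (ones q (suc k))) _ _ (begin
        toℕ (w (p + suc k)) + suc (ones q (suc k))
          ≡⟨ cong (toℕ (w (p + suc k)) +_) (prefix k (suc t) (trans (ℕ.+-suc k (suc t)) e′)) ⟨
        ones p (2 + k)                              ≡⟨ prefix (suc k) t e′ ⟩
        suc (ones q (2 + k))                        ≡⟨ ℕ.+-suc _ (ones q (suc k)) ⟨
        toℕ (w (q + suc k)) + suc (ones q (suc k))  ∎)))
      where
      open ≡-Reasoning
      e′ : suc k + suc t ≡ suc m
      e′ = trans (ℕ.+-suc (suc k) t) (cong suc e)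

    -- The prefix and the suffix of length `k + 1` at `p` each have one 1 more than their
    -- counterparts at `q`, and balance bounds each of them by one more than the counterpart of the
    -- other.
    ones-mirror : ∀ k t → k + suc t ≡ suc m → ones p (suc k) ≡ ones (p + suc t) (suc k)
    ones-mirror k t e = ℕ.≤-antisym
      (ℕ.≤-trans (balanced 1+k≤1+m p (q + suc t)) (ℕ.≤-reflexive (sym suffix)))
      (ℕ.≤-trans (balanced 1+k≤1+m (p + suc t) q) (ℕ.≤-reflexive (sym (prefix k t e))))
      where
      1+k≤1+m : suc k ≤ suc m
      1+k≤1+m = subst (suc k ≤_) (trans (sym (ℕ.+-suc k t)) e) (ℕ.m≤m+n (suc k) t)
      suffix : ones (p + suc t) (suc k) ≡ suc (ones (q + suc t) (suc k))
      suffix = proj₂ (prefix-suffix t k (trans (ℕ.+-suc t k) (trans (ℕ.+-comm (suc t) k) e)))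

    -- Both end letters are 1. Inside, subtracting `ones-mirror` for the lengths `k + 1` and `k + 2`
    -- compares the letter after the prefix with the one before the suffix.
    palindrome-p : PalindromeAt (suc m) p
    palindrome-p zero t refl =
      trans (cong w (ℕ.+-identityʳ p)) (trans (proj₁ first) (sym (proj₁ last)))
    palindrome-p (suc k) zero e with refl ← trans (sym e) (ℕ.+-identityʳ (suc k)) =
      trans (proj₁ last) (trans (sym (proj₁ first)) (cong w (sym (ℕ.+-identityʳ p))))
    palindrome-p (suc k) (suc t) e = Fin.toℕ-injective (ℕ.+-cancelʳ-≡ (ones p (suc k)) _ _ (begin
      ones p (2 + k)                                            ≡⟨ ones-mirror (suc k) t e ⟩
      ones (p + suc t) (2 + k)                                  ≡⟨ ones-cons (p + suc t) (suc k) ⟩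
      toℕ (w (p + suc t)) + ones (suc (p + suc t)) (suc k)
        ≡⟨ cong (λ i → toℕ (w (p + suc t)) + ones i (suc k)) (ℕ.+-suc p (suc t)) ⟨
      toℕ (w (p + suc t)) + ones (p + (2 + t)) (suc k)
        ≡⟨ cong (toℕ (w (p + suc t)) +_) (ones-mirror k (suc t) (trans (ℕ.+-suc k (suc t)) e)) ⟨
      toℕ (w (p + suc t)) + ones p (suc k)                      ∎))
      where open ≡-Reasoning

    palindrome-q : PalindromeAt (suc m) q
    palindrome-q zero t refl =
      trans (cong w (ℕ.+-identityʳ q)) (trans (proj₂ first) (sym (proj₂ last)))
    palindrome-q (suc k) zero e with refl ← trans (sym e) (ℕ.+-identityʳ (suc k)) =
      trans (proj₂ last) (trans (sym (proj₂ first)) (cong w (sym (ℕ.+-identityʳ q))))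
    palindrome-q (suc k) (suc t) e = begin
      w (q + suc k)    ≡⟨ cong w (ℕ.+-suc q k) ⟩
      w (suc q + k)
        ≡⟨ inner k (subst (suc k ≤_) (trans (sym (ℕ.+-suc k t)) (ℕ.suc-injective e)) (ℕ.m≤m+n (suc k) t)) ⟨
      w (suc p + k)    ≡⟨ cong w (ℕ.+-suc p k) ⟨
      w (p + suc k)    ≡⟨ palindrome-p (suc k) (suc t) e ⟩
      w (p + suc t)    ≡⟨ cong w (ℕ.+-suc p t) ⟩
      w (suc p + t)    ≡⟨ inner t (subst (suc t ≤_) (ℕ.suc-injective e) (ℕ.m≤n+m (suc t) k)) ⟩
      w (suc q + t)    ≡⟨ cong w (ℕ.+-suc q t) ⟨
      w (q + suc t)    ∎
      where open ≡-Reasoning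

    special-p : RightSpecial m (suc p)
    special-p = suc q , inner , λ e → case trans (sym one) (trans e zero′) of λ ()
      where
      one : w (suc p + m) ≡ 1F
      one = trans (cong w (sym (ℕ.+-suc p m))) (proj₁ last)
      zero′ : w (suc q + m) ≡ 0F
      zero′ = trans (cong w (sym (ℕ.+-suc q m))) (proj₂ last)

    -- The last `m` letters of a right special block are right special, so by uniqueness they are
    -- the inner block; `palindrome-overlap` then identifies the first letter with that of the block
    -- at `r`.
    special-near : ∀ {r k} → PalindromeAt (suc m) r → SameBlock m (suc p) (suc r) → k ≤ suc m →
                   RightSpecial (suc m) (r + k) → SameBlock (suc m) (r + k) r
    special-near pal same k≤1+m special =
      let tail = same-trans (special-unique (special-tail special) special-p) same
      in same-cons (palindrome-overlap pal k≤1+m tail) tail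

    impossible : ⊥
    impossible =
      -- At length `m + 1` the recurrence yields offsets up to `m + 1`, exactly those of the letters
      -- of the block at `p`.
      special-recurrence (suc m) p λ k k≤ special →
      special-recurrence (suc m) q λ l l≤ special′ →
        let same = same-trans (same-sym (special-near palindrome-p (λ _ _ → refl) k≤ special))
                     (same-trans (special-unique special special′)
                       (special-near palindrome-q inner l≤ special′))
        in case trans (sym (proj₁ first)) (trans (same-head (s≤s z≤n) same) (proj₂ first)) of λ ()

  -- Strong induction: a failure at length `2 + m`, with all shorter lengths balanced, is a minimal
  -- imbalance. Lengths 0 and 1 leave no room for a difference of two.
  balance : ∀ l → Balanced l
  balance = <-rec Balanced go
    where
    go : ∀ l → (∀ {k} → k < l → Balanced k) → Balanced l
    go 0 _ p q = z≤n
    go 1 _ p q = subst (_≤ suc (ones q 1)) (sym (ℕ.+-identityʳ _))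
      (ℕ.≤-trans (Fin.toℕ≤pred[n] (w (p + 0))) (s≤s z≤n))
    go (suc (suc m)) balanced p q with ones p (2 + m) ℕ.≤? suc (ones q (2 + m))
    ... | yes ≤1 = ≤1
    ... | no ≰1  = ⊥-elim (MinimalImbalance.impossible m (λ k≤ → balanced (s≤s k≤)) p q (ℕ.≰⇒> ≰1))

  -- Profiles over a window.

  no-crossing : ∀ {p q a b} → a ≤ b → ones q a < ones p a → ones p b < ones q b → ⊥
  no-crossing {p} {q} {a} {b} a≤b qa<pa pb<qb with t , refl ← ℕ.m≤n⇒∃[o]m+o≡n a≤b =
    ℕ.<-irrefl refl (begin-strict
      ones p (a + t)                          <⟨ pb<qb ⟩
      ones q (a + t)                          ≡⟨ ones-+ q a t ⟩
      ones q a + ones (q + a) t               ≤⟨ ℕ.+-monoʳ-≤ (ones q a) (balance t _ _) ⟩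
      ones q a + suc (ones (p + a) t)         ≡⟨ ℕ.+-suc (ones q a) _ ⟩
      suc (ones q a) + ones (p + a) t         ≤⟨ ℕ.+-monoˡ-≤ _ qa<pa ⟩
      ones p a + ones (p + a) t               ≡⟨ ones-+ p a t ⟨
      ones p (a + t)                          ∎)
    where open ℕ.≤-Reasoning

  -- If profiles at p and q disagreed in opposite directions at two window
  -- elements, the blocks between these would differ by two ones.
  profiles-comparable : ∀ {k} (m : Fin k → ℕ) p q →
    (∀ i → ones p (m i) ≤ ones q (m i)) ⊎ (∀ i → ones q (m i) ≤ ones p (m i))
  profiles-comparable m p q with Fin.all? (λ i → ones p (m i) ℕ.≤? ones q (m i))
                               | Fin.all? (λ i → ones q (m i) ℕ.≤? ones p (m i))
  ... | yes p≤q | _       = inj₁ p≤q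
  ... | no _    | yes q≤p = inj₂ q≤p
  ... | no p≰q  | no q≰p
    with i , pi≰qi ← Fin.¬∀⟶∃¬ _ _ (λ i → ones p (m i) ℕ.≤? ones q (m i)) p≰q
       | j , qj≰pj ← Fin.¬∀⟶∃¬ _ _ (λ i → ones q (m i) ℕ.≤? ones p (m i)) q≰p
    with ℕ.≤-total (m i) (m j)
  ... | inj₁ mi≤mj = ⊥-elim (no-crossing mi≤mj (ℕ.≰⇒> pi≰qi) (ℕ.≰⇒> qj≰pj))
  ... | inj₂ mj≤mi = ⊥-elim (no-crossing mj≤mi (ℕ.≰⇒> qj≰pj) (ℕ.≰⇒> pi≰qi))

  -- Comparable profiles whose sums differ by less than k agree once the sums agree modulo k.
  profile-code : ∀ {k} .{{_ : NonZero k}} → (Fin k → ℕ) → ℕ → Fin k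
  profile-code {k} m p = fromℕ< (m%n<n (Σ (ones p ∘ m)) k)

  profile-code-injective : ∀ {k} .{{_ : NonZero k}} (m : Fin k → ℕ) → (∃[ i ] m i ≡ 0) → ∀ p q →
    profile-code m p ≡ profile-code m q → ones p ∘ m ≗ ones q ∘ m
  profile-code-injective {k} m (i₀ , mi₀≡0) p q e = case profiles-comparable m p q of λ where
      (inj₁ p≤q) → determined p q p≤q codes≡
      (inj₂ q≤p) → sym ∘ determined q p q≤p (sym codes≡)
    where
    codes≡ : Σ (ones p ∘ m) % k ≡ Σ (ones q ∘ m) % k
    codes≡ = Fin.fromℕ<-injective _ _ _ _ e
    determined : ∀ r s → (∀ i → ones r (m i) ≤ ones s (m i)) →
      Σ (ones r ∘ m) % k ≡ Σ (ones s ∘ m) % k → ones r ∘ m ≗ ones s ∘ m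
    determined r s r≤s codes = Σ-≡⇒≗ r≤s (%-≡⇒≡ (Σ-mono-≤ r≤s)
      -- Balance lets each entry grow by at most one, and the entry of the window element 0 not at
      -- all, so the sums differ by less than `k`.
      (Σ-<-+ (λ i → balance (m i) s r)
        (i₀ , subst (λ l → ones s l ≤ ones r l) (sym mi₀≡0) z≤n)) codes)

  SameBlock⇒ones≡ : ∀ {n p q} → SameBlock n p q → ∀ {l} → l ≤ n → ones p l ≡ ones q l
  SameBlock⇒ones≡ same {zero}  _   = refl
  SameBlock⇒ones≡ same {suc l} l<n =
    cong₂ (λ a o → toℕ a + o) (same l l<n) (SameBlock⇒ones≡ same (ℕ.<⇒≤ l<n))

-- Counting distinct values.

distinct-representatives : ∀ {a ℓ} {A : Set a} {_≈_ : Rel A ℓ} → IsDecEquivalence _≈_ →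
  ∀ {m} (r : Fin m → A) →
  ∃[ d ] Σ[ s ∈ (Fin d → A) ] ((∀ {i j} → s i ≈ s j → i ≡ j) × (∀ i → ∃[ j ] r i ≈ s j))
distinct-representatives isDec {zero}  r = 0 , (λ ()) , (λ { {()} }) , λ ()
distinct-representatives {_≈_ = _≈_} isDec {suc m} r
  with d , s , injective , covers ← distinct-representatives isDec (r ∘ Fin.suc)
  with Fin.any? (λ j → IsDecEquivalence._≟_ isDec (r 0F) (s j))
... | yes covered = d , s , injective , λ { 0F → covered ; (Fin.suc i) → covers i }
... | no new = suc d , s′ , (λ {i} {j} → injective′ i j) , covers′
  where
  s′ : Fin (suc d) → _
  s′ 0F          = r 0F
  s′ (Fin.suc j) = s j
  injective′ : ∀ i j → s′ i ≈ s′ j → i ≡ j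
  injective′ 0F          0F          _ = refl
  injective′ 0F          (Fin.suc j) e = contradiction (j , e) new
  injective′ (Fin.suc i) 0F          e = contradiction (i , IsDecEquivalence.sym isDec e) new
  injective′ (Fin.suc i) (Fin.suc j) e = cong Fin.suc (injective e)
  covers′ : ∀ i → ∃[ j ] (r i ≈ s′ j)
  covers′ 0F          = 0F , IsDecEquivalence.refl isDec
  covers′ (Fin.suc i) = let j , e = covers i in Fin.suc j , e

module DistinctValues {a ℓ} (S : Setoid a ℓ) (f : ℕ → Setoid.Carrier S) where
  private module S = Setoid S

  distinctValues : (∀ i j → Dec (f i S.≈ f j)) →
    ∀ {m} (r : Fin m → ℕ) → (∀ i → ∃[ c ] (f i S.≈ f (r c))) →
    ∃[ d ] HasDistinctValues S f d
  distinctValues _≟_ r every with d , s , injective , covers ← distinct-representatives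
    (record { isEquivalence = Setoid.isEquivalence (On.setoid S f) ; _≟_ = _≟_ }) r = d , record
    { to        = to
    ; from      = s
    ; to-cong   = λ {i} {j} e → injective (S.trans (S.sym (to-≈ i)) (S.trans e (to-≈ j)))
    ; from-cong = λ { refl → S.refl }
    ; inverse   = (λ {_} {i} e → injective (S.trans (S.sym (to-≈ i)) e))
                , (λ { {i} refl → S.sym (to-≈ i) })
    }
    where
    to : ℕ → Fin d
    to i = proj₁ (covers (proj₁ (every i)))
    to-≈ : ∀ i → f i S.≈ f (s (to i))
    to-≈ i = S.trans (proj₂ (every i)) (proj₂ (covers (proj₁ (every i))))

  module _ {d k : ℕ} (inverse : HasDistinctValues S f d) where
    open Inverse inverse

    -- Codes are compared at one representative per value, so the values inject into the codes.
    distinctValues-≤ : (code : ℕ → Fin k) → (∀ i j → code i ≡ code j → f i S.≈ f j) → d ≤ k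
    distinctValues-≤ code code-injective = Fin.injective⇒≤ {f = code ∘ from} λ {i} {j} e →
      trans (sym (strictlyInverseˡ i)) (trans (to-cong (code-injective _ _ e)) (strictlyInverseˡ j))

    distinctValues-≥ : (g : Fin k → ℕ) → (∀ i j → f (g i) S.≈ f (g j) → i ≡ j) → k ≤ d
    distinctValues-≥ g g-injective = Fin.injective⇒≤ {f = to ∘ g} λ {i} {j} e →
      g-injective i j (S.trans (S.sym (strictlyInverseʳ (g i)))
        (S.trans (from-cong e) (strictlyInverseʳ (g j))))

-- The order of the reals and the walk.

ℝ<-asym : ∀ {x y} → x ℝ.< y → ¬ (y ℝ.< x)
ℝ<-asym {x} {y} (ε , 0<ε , M , x+ε≤y) (δ , 0<δ , N , y+δ≤x) = ℚ.<-irrefl refl (begin-strict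
  seq x n          ≡⟨ ℚ.+-identityʳ (seq x n) ⟨
  seq x n ℚ.+ 0ℚ   <⟨ ℚ.+-monoʳ-< (seq x n) 0<ε ⟩
  seq x n ℚ.+ ε    ≤⟨ x+ε≤y n (ℕ.m≤m⊔n M N) ⟩
  seq y n          ≡⟨ ℚ.+-identityʳ (seq y n) ⟨
  seq y n ℚ.+ 0ℚ   <⟨ ℚ.+-monoʳ-< (seq y n) 0<δ ⟩
  seq y n ℚ.+ δ    ≤⟨ y+δ≤x n (ℕ.m≤n⊔m M N) ⟩
  seq x n          ∎)
  where
  open ℚ.≤-Reasoning
  n = M ℕ.⊔ N

module SturmianWalk (w : Word) (sturmian : SturmianWord w) (x y a₀ : ℝ) where
  open SturmianCombinatorics w sturmian
  open import Algebra.Definitions.RawMonoid ℚ.+-0-rawMonoid using () renaming (_×_ to _·ℚ_)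

  -- Displacements are computed at each index `k` of the approximating sequences, where rational
  -- identities hold exactly; no equality of reals is involved.
  position : ℕ → ℕ → ℚ
  position k p = seq (walk w x y a₀ p) k

  drift : ℕ → ℕ → ℕ → ℚ
  drift k l o = l ·ℚ seq x k ℚ.- o ·ℚ (seq x k ℚ.+ seq y k)

  -- A step by −y is a step by x followed by one by −(x + y), so that a
  -- displacement depends only on the length and the number of ones.
  position-+ : ∀ k p l → position k (p + l) ≡ position k p ℚ.+ drift k l (ones p l)
  position-+ k p zero = trans (cong (position k) (ℕ.+-identityʳ p)) (sym (ℚ.+-identityʳ _))
  position-+ k p (suc l) = trans (cong (position k) (ℕ.+-suc p l)) (step-drift (w (p + l)))
    where
    open +-*-Solver
    step-drift : ∀ b → seq (step b x y (walk w x y a₀ (p + l))) k ≡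
                       position k p ℚ.+ drift k (suc l) (toℕ b + ones p l)
    step-drift 0F = trans (cong (ℚ._+ seq x k) (position-+ k p l))
      (solve 4 (λ a x s t → (a :+ (s :- t)) :+ x := a :+ ((x :+ s) :- t)) refl
        (position k p) (seq x k) (l ·ℚ seq x k) (ones p l ·ℚ (seq x k ℚ.+ seq y k)))
    step-drift 1F = trans (cong (ℚ._- seq y k) (position-+ k p l))
      (solve 5 (λ a x y s t → (a :+ (s :- t)) :- y := a :+ ((x :+ s) :- ((x :+ y) :+ t))) refl
        (position k p) (seq x k) (seq y k) (l ·ℚ seq x k) (ones p l ·ℚ (seq x k ℚ.+ seq y k)))

  -- Passing from `p` to `q` moves both points by the same `δ k` in every approximation, so the gap
  -- `ε` is kept.
  walk-<-shift : ∀ p q l m → ones p l ≡ ones q l → ones p m ≡ ones q m →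
    walk w x y a₀ (l + p) ℝ.< walk w x y a₀ (m + p) →
    walk w x y a₀ (l + q) ℝ.< walk w x y a₀ (m + q)
  walk-<-shift p q l m el em (ε , 0<ε , N , close) = ε , 0<ε , N , λ k N≤k → begin
    position k (l + q) ℚ.+ ε                                     ≡⟨ cong (ℚ._+ ε) (shift k l el) ⟩
    position k (l + p) ℚ.+ δ k ℚ.+ ε
      ≡⟨ swap (position k (l + p)) (δ k) ε ⟩
    position k (l + p) ℚ.+ ε ℚ.+ δ k
      ≤⟨ ℚ.+-monoˡ-≤ (δ k) (close k N≤k) ⟩
    position k (m + p) ℚ.+ δ k                                   ≡⟨ shift k m em ⟨
    position k (m + q)                                           ∎
    where
    open ℚ.≤-Reasoning
    open +-*-Solver
    δ : ℕ → ℚ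
    δ k = position k q ℚ.- position k p
    swap : ∀ a b c → a ℚ.+ b ℚ.+ c ≡ a ℚ.+ c ℚ.+ b
    swap = solve 3 (λ a b c → a :+ b :+ c := a :+ c :+ b) refl
    shift : ∀ k l → ones p l ≡ ones q l → position k (l + q) ≡ position k (l + p) ℚ.+ δ k
    shift k l e = begin-equality
      position k (l + q)
        ≡⟨ cong (position k) (ℕ.+-comm l q) ⟩
      position k (q + l)                                          ≡⟨ position-+ k q l ⟩
      position k q ℚ.+ drift k l (ones q l)
        ≡⟨ solve 3 (λ a b d → b :+ d := (a :+ d) :+ (b :- a)) refl
             (position k p) (position k q) (drift k l (ones q l)) ⟩
      position k p ℚ.+ drift k l (ones q l) ℚ.+ δ k
        ≡⟨ cong (λ o → position k p ℚ.+ drift k l o ℚ.+ δ k) e ⟨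
      position k p ℚ.+ drift k l (ones p l) ℚ.+ δ k
        ≡⟨ cong (ℚ._+ δ k) (position-+ k p l) ⟨
      position k (p + l) ℚ.+ δ k
        ≡⟨ cong (λ i → position k i ℚ.+ δ k) (ℕ.+-comm p l) ⟩
      position k (l + p) ℚ.+ δ k                                  ∎

  ascent : 0ℝ ℝ.< x → ∀ {i} → w i ≡ 0F → walk w x y a₀ i ℝ.< walk w x y a₀ (suc i)
  ascent (ε , 0<ε , N , ε≤x) {i} wi≡0 = ε , 0<ε , N , λ k N≤k → begin
    position k i ℚ.+ ε
      ≡⟨ cong (position k i ℚ.+_) (ℚ.+-identityˡ ε) ⟨
    position k i ℚ.+ (0ℚ ℚ.+ ε)                       ≤⟨ ℚ.+-monoʳ-≤ (position k i) (ε≤x k N≤k) ⟩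
    position k i ℚ.+ seq x k
      ≡⟨ cong (λ b → seq (step b x y (walk w x y a₀ i)) k) wi≡0 ⟨
    position k (suc i)                                ∎
    where open ℚ.≤-Reasoning

  descent : 0ℝ ℝ.< y → ∀ {i} → w i ≡ 1F → walk w x y a₀ (suc i) ℝ.< walk w x y a₀ i
  descent (ε , 0<ε , N , ε≤y) {i} wi≡1 = ε , 0<ε , N , λ k N≤k → begin
    position k (suc i) ℚ.+ ε
      ≡⟨ cong (λ b → seq (step b x y (walk w x y a₀ i)) k ℚ.+ ε) wi≡1 ⟩
    position k i ℚ.- seq y k ℚ.+ ε
      ≡⟨ cong (position k i ℚ.- seq y k ℚ.+_) (ℚ.+-identityˡ ε) ⟨
    position k i ℚ.- seq y k ℚ.+ (0ℚ ℚ.+ ε)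
      ≤⟨ ℚ.+-monoʳ-≤ (position k i ℚ.- seq y k) (ε≤y k N≤k) ⟩
    position k i ℚ.- seq y k ℚ.+ seq y k
      ≡⟨ solve 2 (λ a y → (a :- y) :+ y := a) refl (position k i) (seq y k) ⟩
    position k i                                      ∎
    where
    open ℚ.≤-Reasoning
    open +-*-Solver

  -- The walk rises at a letter 0 and falls at a letter 1, so its ascents spell the word.
  ascents-determine : 0ℝ ℝ.< x → 0ℝ ℝ.< y → ∀ {i j} →
    (walk w x y a₀ i ℝ.< walk w x y a₀ (suc i) → walk w x y a₀ j ℝ.< walk w x y a₀ (suc j)) →
    (walk w x y a₀ j ℝ.< walk w x y a₀ (suc j) → walk w x y a₀ i ℝ.< walk w x y a₀ (suc i)) →
    w i ≡ w j
  ascents-determine 0<x 0<y {i} {j} to from = letters (w i) (w j) refl refl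
    where
    letters : ∀ a b → w i ≡ a → w j ≡ b → a ≡ b
    letters 0F 0F _  _  = refl
    letters 1F 1F _  _  = refl
    letters 0F 1F wi wj = contradiction (descent 0<y wj)
      (ℝ<-asym {walk w x y a₀ j} {walk w x y a₀ (suc j)} (to (ascent 0<x wi)))
    letters 1F 0F wi wj = contradiction (descent 0<y wi)
      (ℝ<-asym {walk w x y a₀ i} {walk w x y a₀ (suc i)} (from (ascent 0<x wj)))

-- Factors of a Sturmian permutation.

module SturmianFactors (α : Permutation) (sturmianPermutation : SturmianPermutation α) where
  open SturmianPermutation sturmianPermutation
  open SturmianCombinatorics w sturmian
  open SturmianWalk w sturmian x y a₀

  factor-cong : ∀ {k} (T : Window k) {p q} →
    ones p ∘ element T ≗ ones q ∘ element T → factor α T p ∼ factor α T q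
  factor-cong T {p} {q} e =
      (λ {i} {j} → shift p q i j (e i) (e j))
    , (λ {i} {j} → shift q p i j (sym (e i)) (sym (e j)))
    where
    shift : ∀ p q i j → ones p (element T i) ≡ ones q (element T i) →
            ones p (element T j) ≡ ones q (element T j) →
            factor α T p i ℝ.< factor α T p j → factor α T q i ℝ.< factor α T q j
    shift p q i j ei ej lt = proj₂ represents
      (walk-<-shift p q (element T i) (element T j) ei ej (proj₁ represents lt))

  -- The apartness of values at different indices decides their order.
  _<?_ : ∀ s r → Dec (value α s ℝ.< value α r)
  s <? r with s ℕ.≟ r
  ... | yes refl = no λ lt → ℝ<-asym {value α s} {value α s} lt lt
  ... | no s≢r with distinct α s≢r
  ...   | inj₁ s<r = yes s<r
  ...   | inj₂ r<s = no (ℝ<-asym {value α r} {value α s} r<s)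

  _∼?_ : ∀ {k} {T : Window k} p q → Dec (factor α T p ∼ factor α T q)
  _∼?_ {T = T} p q = ⊆? p q ×-dec ⊆? q p
    where
    ⊆? : ∀ p q → Dec (∀ {i j} → factor α T p i ℝ.< factor α T p j →
                               factor α T q i ℝ.< factor α T q j)
    ⊆? p q = map′ (λ f {i} {j} → f i j) (λ f i j → f {i} {j})
      (Fin.all? λ i → Fin.all? λ j →
        ((element T i + p) <? (element T j + p)) →-dec ((element T i + q) <? (element T j + q)))

  patternComplexity : ∀ {k} .{{_ : NonZero k}} (T : Window k) →
                      ∃[ d ] (PatternComplexity α T d × d ≤ k)
  patternComplexity T =
    let d , complexity = distinctValues (_∼?_ {T = T}) (rep n) every
    in d , complexity , distinctValues-≤ complexity (profile-code (element T)) λ p q e →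
         factor-cong T (profile-code-injective (element T) (contains-0 T) p q e)
    where
    open DistinctValues (∼-setoid _) (factor α T)
    -- A length bounding every window element: equal blocks of this length have equal profiles, so
    -- one position per block meets every factor.
    n = Σ (element T)
    every : ∀ p → ∃[ c ] (factor α T p ∼ factor α T (rep n c))
    every p = class n p , factor-cong T λ i →
      SameBlock⇒ones≡ (same-sym (rep-class n p)) (≤-Σ (element T) i)

  initialSegment : ∀ n → Window (suc n)
  initialSegment n = record { element = toℕ ; increasing = λ i<j → i<j ; contains-0 = 0F , refl }

  -- The order of the consecutive window elements `k` and `k + 1` in the factor tells whether the
  -- walk rises there, which gives the letter at offset `k`.
  factor-initialSegment : ∀ n {p q} →
    factor α (initialSegment n) p ∼ factor α (initialSegment n) q → SameBlock n p q
  factor-initialSegment n {p} {q} (to , from) k k<n = ascents-determine x-positive y-positive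
    (transfer p q (to {i} {j})) (transfer q p (from {i} {j}))
    where
    i = fromℕ< (ℕ.m<n⇒m<1+n k<n)
    j = fromℕ< (s≤s k<n)
    index-i : ∀ r → toℕ i + r ≡ r + k
    index-i r = trans (cong (_+ r) (Fin.toℕ-fromℕ< (ℕ.m<n⇒m<1+n k<n))) (ℕ.+-comm k r)
    index-j : ∀ r → toℕ j + r ≡ suc (r + k)
    index-j r = trans (cong (_+ r) (Fin.toℕ-fromℕ< (s≤s k<n))) (cong suc (ℕ.+-comm k r))
    transfer : ∀ r s →
      (value α (toℕ i + r) ℝ.< value α (toℕ j + r) → value α (toℕ i + s) ℝ.< value α (toℕ j + s)) →
      walk w x y a₀ (r + k) ℝ.< walk w x y a₀ (suc (r + k)) →
      walk w x y a₀ (s + k) ℝ.< walk w x y a₀ (suc (s + k))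
    transfer r s f lt =
      subst₂ (λ a b → walk w x y a₀ a ℝ.< walk w x y a₀ b) (index-i s) (index-j s)
        (proj₁ represents (f (proj₂ represents
          (subst₂ (λ a b → walk w x y a₀ a ℝ.< walk w x y a₀ b)
            (sym (index-i r)) (sym (index-j r)) lt))))

  -- The `n + 1` different blocks of length `n` yield pairwise different factors, so the upper bound
  -- is attained.
  initialSegment-complexity : ∀ n → PatternComplexity α (initialSegment n) (suc n)
  initialSegment-complexity n =
    let d , complexity , d≤ = patternComplexity (initialSegment n)
        ≤d = distinctValues-≥ complexity (rep n) λ c e eq → rep-injective (factor-initialSegment n eq)
    in subst (PatternComplexity α (initialSegment n)) (ℕ.≤-antisym d≤ ≤d) complexity
    where open DistinctValues (∼-setoid _) (factor α (initialSegment n))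

theorem5 : ∀ (α : Permutation) → SturmianPermutation α →
    ∀ (n : ℕ) → n ≥ 1 → MaximalPatternComplexity α n n
theorem5 α S (suc n) _ = (initialSegment n , initialSegment-complexity n) , patternComplexity
  where open SturmianFactors α S
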